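{- Let $p\ge5$ be prime and let $A,B\in\mathbb{Z}$ with $p\mid A$ and $p\mid B$. For $k\ge1$ let $M_k$ be the number of $(x,y)\in(\mathbb{Z}/p^k\mathbb{Z})^2$ with $y^2\equiv x^3+Ax+B\pmod{p^k}$ and $x\equiv y\equiv 0\pmod p$. Let $\alpha=v_p(A)\ge1$ and $\beta=v_p(B)\ge1$ (possibly $\infty$). Exactly one of the following eight rows of conditions applies, each row having an associated integer $h$. In the row that applies, \[ M_1=1,\qquad M_k=p^k\quad(2\le k<h), \] and for every $k\ge h$ the value of $M_k$ is as follows. Row 1: $\beta=1$; $h=2$; $M_k=0$ for $k\ge h$. Row 2: $\alpha=1$, $\beta\ge2$; $h=2$; $M_k=p^k$ for $k\ge h$. Row 3: $\alpha\ge2$, $\beta=2$; $h=3$; $M_k=(1+\chi(B/p^2))\,p^k$ for $k\ge h$. Row 4: $\alpha\ge2$, $\beta\ge3$, and ($\alpha=2$ or $\beta=3$); $h=4$; $M_k=p^3K_{k-3}(A/p^2,B/p^3)$ for $k\ge h$. Row 5: $\alpha\ge3$, $\beta=4$; $h=5$; $M_k=(1+\chi(B/p^4))\,p^k$ for $k\ge h$. Row 6: $\alpha=3$, $\beta\ge5$; $h=5$; $M_k=p^k$ for $k\ge h$. Row 7: $\alpha\ge4$, $\beta=5$; $h=6$; $M_k=0$ for $k\ge h$. Row 8: $\alpha\ge4$, $\beta\ge6$; $h=6$; $M_k=p^7N_{k-6}(A/p^4,B/p^6)$ for $k\ge h$.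
   Context: $v_p$ is the $p$-adic valuation with $v_p(0)=\infty$. $\chi(u)=\left(\frac{u}{p}\right)$ is the Legendre symbol modulo $p$. For $a,b\in\mathbb{Z}$ and $j\ge1$, \[ N_j(a,b)=\#\{(x,y)\bmod p^j : y^2\equiv x^3+ax+b\pmod{p^j}\},\qquad N_0(a,b)=1. \] For $a,b\in\mathbb{Z}$ not both divisible by $p$ and $\ell\ge1$, \[ K_\ell(a,b)=\#\{(X,Y)\bmod p^\ell : X^3+aX+b\equiv pY^2\pmod{p^\ell}\},\qquad K_0=1. \] Here "$(x,y)\bmod p^j$" means both coordinates range over $\mathbb{Z}/p^j\mathbb{Z}$. -}

module Defs where

open import Data.Bool.Base using (if_then_else_)
open import Data.Fin.Base using (Fin; toℕ)
open import Data.Fin.Properties using (any?)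
open import Data.Integer.Base using (ℤ; +_; 0ℤ; 1ℤ; -1ℤ; _+_; _-_; _*_; _/ℕ_; ∣_∣)
  renaming (_^_ to _^ℤ_)
open import Data.Integer.Divisibility.Signed using (_∣_; _∣?_)
open import Data.Integer.Properties using () renaming (_≟_ to _≟ℤ_)
open import Data.List.Base using (length; filter; cartesianProduct; allFin)
open import Data.Nat.Base as ℕ using (ℕ; zero; suc; NonZero; _≤_; _^_; _∸_)
open import Data.Nat.Properties using (m^n≢0)
open import Data.Product.Base using (_×_; _,_)
open import Data.Sum.Base using (_⊎_)
open import Relation.Binary.Construct.Add.Supremum.NonStrict _≤_ using (_≤⁺_)
open import Relation.Binary.PropositionalEquality.Core using (_≡_)
open import Relation.Nullary.Construct.Add.Supremum using (_⁺; ⊤⁺; [_])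
open import Relation.Nullary.Decidable using (Dec; does; _×-dec_)
open import Relation.Unary using (Decidable)

infix 4 _≈_[mod_] _≈?_[mod_]

_≈_[mod_] : ℤ → ℤ → ℕ → Set
a ≈ b [mod n ] = + n ∣ a - b

_≈?_[mod_] : ∀ a b n → Dec (a ≈ b [mod n ])
a ≈? b [mod n ] = + n ∣? a - b

-- The residue classes modulo n are represented by 0, …, n ∸ 1.
rep : ∀ {n} → Fin n → ℤ
rep x = + toℕ x

#pairs : ∀ n {P : Fin n × Fin n → Set} → Decidable P → ℕ
#pairs n P? = length (filter P? (cartesianProduct (allFin n) (allFin n)))

greatest : {P : ℕ → Set} → Decidable P → ℕ → ℕ
greatest P? zero    = zero
greatest P? (suc n) = if does (P? (suc n)) then suc n else greatest P? n

-- The p-adic valuation for p ≥ 2, with ∞ = ⊤⁺.  If z ≢ 0 and p ^ e ∣ z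
-- then e < p ^ e ≤ ∣ z ∣, so the search up to ∣ z ∣ finds every such e.
v : ℕ → ℤ → ℕ ⁺
v p z = if does (z ≟ℤ 0ℤ)
        then ⊤⁺
        else [ greatest (λ e → + (p ^ e) ∣? z) ∣ z ∣ ]

-- The Legendre symbol (u / p).
χ : ℕ → ℤ → ℤ
χ p u = if does (+ p ∣? u) then 0ℤ
        else if does (any? {n = p} λ x → rep x ^ℤ 2 ≈? u [mod p ]) then 1ℤ
        else -1ℤ

N : ℕ → ℕ → ℤ → ℤ → ℕ
N p zero      a b = 1
N p j@(suc _) a b = #pairs (p ^ j) λ (x , y) →
  rep y ^ℤ 2 ≈? rep x ^ℤ 3 + a * rep x + b [mod p ^ j ]

-- Of interest only when a and b are not both divisible by p.
K : ℕ → ℕ → ℤ → ℤ → ℕ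
K p zero      a b = 1
K p l@(suc _) a b = #pairs (p ^ l) λ (X , Y) →
  rep X ^ℤ 3 + a * rep X + b ≈? + p * rep Y ^ℤ 2 [mod p ^ l ]

-- The conditions x ≡ y ≡ 0 (mod p) are independent of the chosen
-- representatives modulo p ^ k only for k ≥ 1.
M : ℕ → ℕ → ℤ → ℤ → ℕ
M p k A B = #pairs (p ^ k) λ (x , y) →
  (rep y ^ℤ 2 ≈? rep x ^ℤ 3 + A * rep x + B [mod p ^ k ])
    ×-dec (rep x ≈? 0ℤ [mod p ]) ×-dec (rep y ≈? 0ℤ [mod p ])

-- z / p ^ e rounded down; used only where p ^ e divides z.
quot : (p : ℕ) .{{_ : NonZero p}} → ℤ → ℕ → ℤ
quot p z e = (z /ℕ (p ^ e)) {{m^n≢0 p e}}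

data Row : Set where
  row1 row2 row3 row4 row5 row6 row7 row8 : Row

Applies : Row → (α β : ℕ ⁺) → Set
Applies row1 α β = β ≡ [ 1 ]
Applies row2 α β = α ≡ [ 1 ] × [ 2 ] ≤⁺ β
Applies row3 α β = [ 2 ] ≤⁺ α × β ≡ [ 2 ]
Applies row4 α β = [ 2 ] ≤⁺ α × [ 3 ] ≤⁺ β × (α ≡ [ 2 ] ⊎ β ≡ [ 3 ])
Applies row5 α β = [ 3 ] ≤⁺ α × β ≡ [ 4 ]
Applies row6 α β = α ≡ [ 3 ] × [ 5 ] ≤⁺ β
Applies row7 α β = [ 4 ] ≤⁺ α × β ≡ [ 5 ]
Applies row8 α β = [ 4 ] ≤⁺ α × [ 6 ] ≤⁺ β

h : Row → ℕ
h row1 = 2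
h row2 = 2
h row3 = 3
h row4 = 4
h row5 = 5
h row6 = 5
h row7 = 6
h row8 = 6

-- The value of M p k A B for k ≥ h r.
value : (p : ℕ) .{{_ : NonZero p}} → ℤ → ℤ → Row → ℕ → ℤ
value p A B row1 k = 0ℤ
value p A B row2 k = + (p ^ k)
value p A B row3 k = (1ℤ + χ p (quot p B 2)) * + (p ^ k)
value p A B row4 k = + (p ^ 3 ℕ.* K p (k ∸ 3) (quot p A 2) (quot p B 3))
value p A B row5 k = (1ℤ + χ p (quot p B 4)) * + (p ^ k)
value p A B row6 k = + (p ^ k)
value p A B row7 k = 0ℤ
value p A B row8 k = + (p ^ 7 ℕ.* N p (k ∸ 6) (quot p A 4) (quot p B 6))

{-# OPTIONS --safe #-}

-- All counts that occur are numbers Z j u c a b of zeros modulo p ^ j of a curve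
-- c x³ + a x + b = u y².  The substitutions x = p X and y = p Y turn M p (2 + j) into p ^ 2 times
-- such a number.  If u (or c) is a unit and the other coefficients are divisible by p, then p
-- divides y (or x), so one more substitution lowers j by one and gains a factor p; if all
-- coefficients are divisible by p, dividing by p lowers j by one and gains p ^ 2.  The descent
-- stops at the first unit among a and b: when p divides c, a unit a leaves exactly one x for each
-- y, and, when p also divides a, a unit b leaves 1 + χ(b) values of y for each x if u = 1 and none
-- if p divides u.  In row 4 it stops at the curve p y² = x³ + a x + b that defines K, and in row 8
-- at y² = x³ + a x + b.
module Submission where

open import Defs
open import Data.Bool.Base using (true; false; if_then_else_)
open import Data.Fin.Base using (Fin; zero; suc; toℕ; fromℕ<; punchOut)
open import Data.Fin.Properties using (_≟_; any?; toℕ<n; toℕ-injective; toℕ-fromℕ<;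
  fromℕ<-injective; punchOut-injective; injective⇒≤)
open import Data.Integer.Base using (ℤ; +_; -_; 0ℤ; 1ℤ; _+_; _-_; _*_; ∣_∣; _%ℕ_; _/ℕ_;
  ≢-nonZero) renaming (_^_ to _^ℤ_)
open import Data.Integer.Divisibility.Signed
open import Data.Integer.DivMod using (n%ℕd<d; a≡a%ℕn+[a/ℕn]*n)
import Data.Integer.Properties as ℤ
open import Data.Integer.Tactic.RingSolver using (solve-∀)
open import Data.List.Base using (_++_; length; filter; cartesianProduct; allFin; map; tabulate)
open import Data.List.Properties using (filter-++; length-++; map-tabulate)
open import Data.Nat.Base as ℕ using (ℕ; zero; suc; NonZero; _≤_; _<_; _^_; z≤n; s≤s; z<s; s<s)
import Data.Nat.Divisibility as ℕ∣
open import Data.Nat.Primality using (Prime; prime⇒nonZero; euclidsLemma)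
import Data.Nat.Properties as ℕ
import Data.Nat.Tactic.RingSolver as ℕSolver
open import Data.Product using (_×_; ∃!; ∃; _,_; proj₁; proj₂)
open import Data.Sum.Base using (_⊎_; inj₁; inj₂; [_,_]′)
open import Function.Base using (_∘_; id)
open import Function.Bundles using (mk⇔)
open import Function.Definitions using (Injective)
open import Relation.Binary.Construct.Add.Supremum.NonStrict _≤_
  using (_≤⁺_; [_]; _≤⊤⁺; [≤]-injective; ≤⁺-trans)
open import Relation.Binary.PropositionalEquality
open import Relation.Nullary.Construct.Add.Supremum using (_⁺; ⊤⁺; [_])
open import Relation.Nullary using (Dec; yes; no; does; ¬_; contradiction)
open import Relation.Nullary.Decidable using (_×-dec_; does-⇔; dec-true; dec-false)
open import Relation.Unary using (Decidable)

-- Sums over initial segments of ℕ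

-- The Iverson bracket, which turns counts into sums that can be split and reindexed.
⟦_⟧ : {P : Set} → Dec P → ℕ
⟦ P? ⟧ = if does P? then 1 else 0

module _ {P : Set} (P? : Dec P) where

  ⟦⟧-true : P → ⟦ P? ⟧ ≡ 1
  ⟦⟧-true p rewrite dec-true P? p = refl

  ⟦⟧-false : ¬ P → ⟦ P? ⟧ ≡ 0
  ⟦⟧-false ¬p rewrite dec-false P? ¬p = refl

⟦⟧-cong : {P Q : Set} (P? : Dec P) (Q? : Dec Q) → (P → Q) → (Q → P) → ⟦ P? ⟧ ≡ ⟦ Q? ⟧
⟦⟧-cong P? Q? f g rewrite does-⇔ (mk⇔ f g) P? Q? = refl

∑< : ℕ → (ℕ → ℕ) → ℕ
∑< zero    f = 0
∑< (suc n) f = f 0 ℕ.+ ∑< n (f ∘ suc)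

infixr 5 ∑<
syntax ∑< n (λ i → e) = ∑[ i < n ] e

∑-cong : ∀ n {f g} → (∀ i → i < n → f i ≡ g i) → ∑< n f ≡ ∑< n g
∑-cong zero    eq = refl
∑-cong (suc n) eq = cong₂ ℕ._+_ (eq 0 z<s) (∑-cong n λ i i<n → eq (suc i) (s<s i<n))

∑-const : ∀ n c → (∑[ _ < n ] c) ≡ n ℕ.* c
∑-const zero    c = refl
∑-const (suc n) c = cong (c ℕ.+_) (∑-const n c)

∑-zero : ∀ n {f} → (∀ i → i < n → f i ≡ 0) → ∑< n f ≡ 0
∑-zero n eq = trans (∑-cong n eq) (trans (∑-const n 0) (ℕ.*-zeroʳ n))

∑-+ : ∀ n f g → (∑[ i < n ] f i ℕ.+ g i) ≡ ∑< n f ℕ.+ ∑< n g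
∑-+ zero    f g = refl
∑-+ (suc n) f g = trans (cong (f 0 ℕ.+ g 0 ℕ.+_) (∑-+ n (f ∘ suc) (g ∘ suc)))
                        (interchange (f 0) (g 0) _ _)
  where
  interchange : ∀ a b c d → a ℕ.+ b ℕ.+ (c ℕ.+ d) ≡ a ℕ.+ c ℕ.+ (b ℕ.+ d)
  interchange = ℕSolver.solve-∀

∑-swap : ∀ m n (f : ℕ → ℕ → ℕ) → (∑[ i < m ] ∑[ j < n ] f i j) ≡ (∑[ j < n ] ∑[ i < m ] f i j)
∑-swap zero    n f = sym (∑-zero n λ _ _ → refl)
∑-swap (suc m) n f = trans (cong (∑< n (f 0) ℕ.+_) (∑-swap m n (f ∘ suc))) (sym (∑-+ n _ _))

∑-*ˡ : ∀ n c f → (∑[ i < n ] c ℕ.* f i) ≡ c ℕ.* ∑< n f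
∑-*ˡ zero    c f = sym (ℕ.*-zeroʳ c)
∑-*ˡ (suc n) c f = trans (cong (c ℕ.* f 0 ℕ.+_) (∑-*ˡ n c (f ∘ suc))) (sym (ℕ.*-distribˡ-+ c _ _))

∑-++ : ∀ m n f → ∑< (m ℕ.+ n) f ≡ ∑< m f ℕ.+ ∑< n (λ i → f (m ℕ.+ i))
∑-++ zero    n f = refl
∑-++ (suc m) n f = trans (cong (f 0 ℕ.+_) (∑-++ m n (f ∘ suc))) (sym (ℕ.+-assoc (f 0) _ _))

∑-blocks : ∀ q m f → ∑< (q ℕ.* m) f ≡ ∑[ t < q ] ∑[ r < m ] f (t ℕ.* m ℕ.+ r)
∑-blocks zero    m f = refl
∑-blocks (suc q) m f = begin
  ∑< (m ℕ.+ q ℕ.* m) f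
    ≡⟨ ∑-++ m (q ℕ.* m) f ⟩
  ∑< m f ℕ.+ ∑< (q ℕ.* m) (λ i → f (m ℕ.+ i))
    ≡⟨ cong (∑< m f ℕ.+_) (∑-blocks q m _) ⟩
  ∑< m f ℕ.+ (∑[ t < q ] ∑[ r < m ] f (m ℕ.+ (t ℕ.* m ℕ.+ r)))
    ≡⟨ cong (∑< m f ℕ.+_) (∑-cong q λ t _ → ∑-cong m λ r _ → cong f (sym (ℕ.+-assoc m _ r))) ⟩
  ∑< m f ℕ.+ (∑[ t < q ] ∑[ r < m ] f (suc t ℕ.* m ℕ.+ r))
    ∎
  where open ≡-Reasoning

∑-periodic : ∀ q m {f} → (∀ t r → f (t ℕ.* m ℕ.+ r) ≡ f r) → ∑< (q ℕ.* m) f ≡ q ℕ.* ∑< m f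
∑-periodic q m {f} per = trans (∑-blocks q m f)
  (trans (∑-cong q λ t _ → ∑-cong m λ r _ → per t r) (∑-const q _))

∑-multiples : ∀ p .{{_ : NonZero p}} m {f} → (∀ i → ¬ p ℕ∣.∣ i → f i ≡ 0) →
              ∑< (p ℕ.* m) f ≡ ∑[ i < m ] f (p ℕ.* i)
∑-multiples p@(suc p′) m {f} vanish = begin
  ∑< (p ℕ.* m) f
    ≡⟨ cong (λ n → ∑< n f) (ℕ.*-comm p m) ⟩
  ∑< (m ℕ.* p) f
    ≡⟨ ∑-blocks m p f ⟩
  -- In each block of length `p` only the offset `0` gives a multiple of `p`.
  (∑[ t < m ] f (t ℕ.* p ℕ.+ 0) ℕ.+ (∑[ r < p′ ] f (t ℕ.* p ℕ.+ suc r)))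
    ≡⟨ ∑-cong m (λ t _ → cong₂ ℕ._+_ (cong f (trans (ℕ.+-identityʳ _) (ℕ.*-comm t p)))
         (∑-zero p′ λ r r<p′ → vanish _ λ p∣ → ℕ∣.>⇒∤ (s<s r<p′) (ℕ∣.∣m+n∣m⇒∣n p∣ (ℕ∣.n∣m*n t)))) ⟩
  (∑[ t < m ] f (p ℕ.* t) ℕ.+ 0)
    ≡⟨ ∑-cong m (λ t _ → ℕ.+-identityʳ _) ⟩
  (∑[ i < m ] f (p ℕ.* i))
    ∎
  where open ≡-Reasoning

∑-single : ∀ {n i} f → i < n → (∀ j → j < n → j ≢ i → f j ≡ 0) → ∑< n f ≡ f i
∑-single {suc n} {zero} f z<s vanish =
  trans (cong (f 0 ℕ.+_) (∑-zero n λ j j<n → vanish (suc j) (s<s j<n) λ ())) (ℕ.+-identityʳ (f 0))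
∑-single {suc n} {suc i} f (s<s i<n) vanish = trans
  (cong (ℕ._+ ∑< n (f ∘ suc)) (vanish 0 z<s λ ()))
  (∑-single (f ∘ suc) i<n λ j j<n j≢i → vanish (suc j) (s<s j<n) (j≢i ∘ ℕ.suc-injective))

-- Counts of pairs as double sums

length-filter-tabulate : ∀ {A : Set} {P : A → Set} (P? : Decidable P) {n} (g : Fin n → A) {f} →
  (∀ i → ⟦ P? (g i) ⟧ ≡ f (toℕ i)) → length (filter P? (tabulate g)) ≡ ∑< n f
length-filter-tabulate P? {zero}  g eq = refl
length-filter-tabulate P? {suc n} g eq
  with does (P? (g zero)) | eq zero | length-filter-tabulate P? (g ∘ suc) (eq ∘ suc)
... | true  | e | ih = cong₂ ℕ._+_ e ih
... | false | e | ih = cong₂ ℕ._+_ e ih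

#pairs-∑ : ∀ n {P : Fin n × Fin n → Set} (P? : Decidable P) {f : ℕ → ℕ → ℕ} →
  (∀ x y → ⟦ P? (x , y) ⟧ ≡ f (toℕ x) (toℕ y)) → #pairs n P? ≡ ∑[ x < n ] ∑[ y < n ] f x y
#pairs-∑ n {P} P? {f} eq = go id eq
  where
  -- The induction needs an arbitrary `g` in the first coordinate, since the tail of `tabulate g` is
  -- `tabulate (g ∘ suc)`; the second coordinate keeps its full range.
  go : ∀ {m} (g : Fin m → Fin n) {f : ℕ → ℕ → ℕ} → (∀ x y → ⟦ P? (g x , y) ⟧ ≡ f (toℕ x) (toℕ y)) →
       length (filter P? (cartesianProduct (tabulate g) (allFin n))) ≡ ∑[ x < m ] ∑[ y < n ] f x y
  go {zero}  g eq = refl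
  go {suc m} g {f} eq = begin
    length (filter P? (row ++ rest))
      ≡⟨ cong length (filter-++ P? row rest) ⟩
    length (filter P? row ++ filter P? rest)
      ≡⟨ length-++ (filter P? row) ⟩
    length (filter P? row) ℕ.+ length (filter P? rest)
      ≡⟨ cong₂ ℕ._+_
           (trans (cong (length ∘ filter P?) (map-tabulate id (g zero ,_)))
                  (length-filter-tabulate P? (g zero ,_) (eq zero)))
           (go (g ∘ suc) (eq ∘ suc)) ⟩
    (∑[ y < n ] f 0 y) ℕ.+ (∑[ x < m ] ∑[ y < n ] f (suc x) y)
      ∎
    where
    open ≡-Reasoning
    row  = map (g zero ,_) (allFin n)
    rest = cartesianProduct (tabulate (g ∘ suc)) (allFin n)

⟦⟧-⊎ : {P Q R : Set} (P? : Dec P) (Q? : Dec Q) (R? : Dec R) →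
  (P → Q ⊎ R) → (Q → P) → (R → P) → ¬ (Q × R) → ⟦ P? ⟧ ≡ ⟦ Q? ⟧ ℕ.+ ⟦ R? ⟧
⟦⟧-⊎ P? (yes q) (yes r) split fromQ fromR disjoint = contradiction (q , r) disjoint
⟦⟧-⊎ P? (yes q) (no ¬r) split fromQ fromR disjoint = ⟦⟧-true P? (fromQ q)
⟦⟧-⊎ P? (no ¬q) (yes r) split fromQ fromR disjoint = ⟦⟧-true P? (fromR r)
⟦⟧-⊎ P? (no ¬q) (no ¬r) split fromQ fromR disjoint = ⟦⟧-false P? ([ ¬q , ¬r ]′ ∘ split)

-- Congruences, residues and the pigeonhole principle

∣-congruent : ∀ {n z z′} → n ∣ z - z′ → n ∣ z → n ∣ z′
∣-congruent {z = z} {z′} n∣z-z′ n∣z = subst (_ ∣_) (identity z z′) (∣m∣n⇒∣m-n n∣z n∣z-z′)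
  where
  identity : ∀ z z′ → z - (z - z′) ≡ z′
  identity = solve-∀

∣-sym : ∀ {n} z z′ → n ∣ z - z′ → n ∣ z′ - z
∣-sym z z′ n∣ = subst (_ ∣_) (identity z z′) (∣m⇒∣-m n∣)
  where
  identity : ∀ z z′ → - (z - z′) ≡ z′ - z
  identity = solve-∀

⟦∣⟧-congruent : ∀ q z z′ → + q ∣ z - z′ → ⟦ + q ∣? z ⟧ ≡ ⟦ + q ∣? z′ ⟧
⟦∣⟧-congruent q z z′ q∣ =
  ⟦⟧-cong (+ q ∣? z) (+ q ∣? z′) (∣-congruent q∣) (∣-congruent (∣-sym z z′ q∣))

⟦∣⟧-neg : ∀ q z → ⟦ + q ∣? - z ⟧ ≡ ⟦ + q ∣? z ⟧
⟦∣⟧-neg q z = ⟦⟧-cong (+ q ∣? - z) (+ q ∣? z) (subst (_ ∣_) (ℤ.neg-involutive z) ∘ ∣m⇒∣-m) ∣m⇒∣-m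

-- If `b < a`, then `n` would divide the positive number `a ∸ b`, which is smaller than `n`.
residue-≤ : ∀ {n a b} → a < n → + n ∣ + a - + b → a ≤ b
residue-≤ {n} {a} {b} a<n n∣a-b with a ℕ.≤? b
... | yes a≤b = a≤b
... | no  a≰b = contradiction (ℕ∣.∣⇒≤ {{ℕ.>-nonZero (ℕ.m<n⇒0<n∸m b<a)}} n∣a∸b)
                              (ℕ.<⇒≱ (ℕ.≤-<-trans (ℕ.m∸n≤m a b) a<n))
  where
  b<a = ℕ.≰⇒> a≰b
  n∣a∸b : n ℕ∣.∣ a ℕ.∸ b
  n∣a∸b = ∣⇒∣ᵤ (subst (+ n ∣_) (trans (ℤ.[+m]-[+n]≡m⊖n a b) (ℤ.⊖-≥ (ℕ.<⇒≤ b<a))) n∣a-b)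

residue-≡ : ∀ {n a b} → a < n → b < n → + n ∣ + a - + b → a ≡ b
residue-≡ {a = a} {b} a<n b<n n∣a-b =
  ℕ.≤-antisym (residue-≤ a<n n∣a-b) (residue-≤ b<n (∣-sym (+ a) (+ b) n∣a-b))

-- Removing a missed value `y` from the codomain by `punchOut` would leave an injection from `suc n`
-- elements into `n`.
injective⇒surjective : ∀ {n} {f : Fin n → Fin n} → Injective _≡_ _≡_ f → ∀ y → ∃ λ x → f x ≡ y
injective⇒surjective {suc n} {f} f-inj y with any? (λ x → f x ≟ y)
... | yes hit  = hit
... | no  miss = contradiction
  (injective⇒≤ {f = λ x → punchOut {i = y} {j = f x} (λ y≡fx → miss (x , sym y≡fx))}
    λ eq → f-inj (punchOut-injective {i = y} _ _ eq))
  ℕ.1+n≰n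

-- Reduction modulo `n` makes `f` an injective self-map of `Fin n`. It is therefore surjective, so
-- the residue `0` is attained, and by injectivity only once.
∑-unique-zero : ∀ n .{{_ : NonZero n}} (f : ℤ → ℤ) →
  (∀ x y → + n ∣ f x - f y → + n ∣ x - y) → ∑[ x < n ] ⟦ + n ∣? f (+ x) ⟧ ≡ 1
∑-unique-zero n@(suc _) f f-inj = trans
  (∑-single (λ x → ⟦ + n ∣? f (+ x) ⟧) (toℕ<n x₀) λ y y<n y≢x₀ →
    ⟦⟧-false (+ n ∣? f (+ y)) λ n∣fy → y≢x₀ (residue-≡ y<n (toℕ<n x₀)
      (f-inj (+ y) (+ toℕ x₀) (∣m∣n⇒∣m-n n∣fy n∣fx₀))))
  (⟦⟧-true (+ n ∣? f (+ toℕ x₀)) n∣fx₀)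
  where
  residue : Fin n → Fin n
  residue x = fromℕ< (n%ℕd<d (f (+ toℕ x)) n)

  f-decompose : ∀ x → f x ≡ + (f x %ℕ n) + (f x /ℕ n) * + n
  f-decompose x = a≡a%ℕn+[a/ℕn]*n (f x) n

  residue-injective : Injective _≡_ _≡_ residue
  residue-injective {x} {y} eq = toℕ-injective (residue-≡ (toℕ<n x) (toℕ<n y)
    (f-inj (+ toℕ x) (+ toℕ y) (divides (f (+ toℕ x) /ℕ n - f (+ toℕ y) /ℕ n) (begin
      f (+ toℕ x) - f (+ toℕ y)
        ≡⟨ cong₂ _-_ (f-decompose (+ toℕ x)) (f-decompose (+ toℕ y)) ⟩
      + (f (+ toℕ x) %ℕ n) + (f (+ toℕ x) /ℕ n) * + n
        - (+ (f (+ toℕ y) %ℕ n) + (f (+ toℕ y) /ℕ n) * + n)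
        ≡⟨ cong (λ r → + (f (+ toℕ x) %ℕ n) + (f (+ toℕ x) /ℕ n) * + n - (+ r + (f (+ toℕ y) /ℕ n) * + n))
             (sym (fromℕ<-injective _ _ _ _ eq)) ⟩
      + (f (+ toℕ x) %ℕ n) + (f (+ toℕ x) /ℕ n) * + n
        - (+ (f (+ toℕ x) %ℕ n) + (f (+ toℕ y) /ℕ n) * + n)
        ≡⟨ identity (+ (f (+ toℕ x) %ℕ n)) (f (+ toℕ x) /ℕ n) (f (+ toℕ y) /ℕ n) (+ n) ⟩
      (f (+ toℕ x) /ℕ n - f (+ toℕ y) /ℕ n) * + n
        ∎))))
    where
    open ≡-Reasoning
    identity : ∀ r s t n → r + s * n - (r + t * n) ≡ (s - t) * n
    identity = solve-∀

  x₀ = proj₁ (injective⇒surjective residue-injective zero)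

  n∣fx₀ : + n ∣ f (+ toℕ x₀)
  n∣fx₀ = divides (f (+ toℕ x₀) /ℕ n) (begin
    f (+ toℕ x₀)
      ≡⟨ f-decompose (+ toℕ x₀) ⟩
    + (f (+ toℕ x₀) %ℕ n) + (f (+ toℕ x₀) /ℕ n) * + n
      ≡⟨ cong (λ r → + r + (f (+ toℕ x₀) /ℕ n) * + n)
           (trans (sym (toℕ-fromℕ< _)) (cong toℕ (proj₂ (injective⇒surjective residue-injective zero)))) ⟩
    0ℤ + (f (+ toℕ x₀) /ℕ n) * + n
      ≡⟨ ℤ.+-identityˡ _ ⟩
    (f (+ toℕ x₀) /ℕ n) * + n
      ∎)
    where open ≡-Reasoning

-- Zeros of curves in boxes

curve : (u c a b x y : ℤ) → ℤ
curve u c a b x y = c * (x * x * x) + a * x + b - u * (y * y)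

-- The factor `x - x′` gives periodicity in `x`; the cofactor is the difference quotient to which
-- Hensel's lemma is applied.
curve-Δx : ∀ u c a b x x′ y →
  curve u c a b x y - curve u c a b x′ y ≡ (x - x′) * (a + c * (x * x + x * x′ + x′ * x′))
curve-Δx = unfolded
  where
  unfolded : ∀ u c a b x x′ y →
    c * (x * x * x) + a * x + b - u * (y * y) - (c * (x′ * x′ * x′) + a * x′ + b - u * (y * y))
      ≡ (x - x′) * (a + c * (x * x + x * x′ + x′ * x′))
  unfolded = solve-∀

curve-Δy : ∀ u c a b x y y′ → curve u c a b x y - curve u c a b x y′ ≡ (y - y′) * (- u * (y + y′))
curve-Δy = unfolded
  where
  unfolded : ∀ u c a b x y y′ →
    c * (x * x * x) + a * x + b - u * (y * y) - (c * (x * x * x) + a * x + b - u * (y′ * y′))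
      ≡ (y - y′) * (- u * (y + y′))
  unfolded = solve-∀

-- The sides of the box and the modulus vary separately: substituting a multiple of `p` shortens one
-- side, while cancelling `p` lowers only the modulus.
zeros : (m n q : ℕ) (u c a b : ℤ) → ℕ
zeros m n q u c a b = ∑[ x < m ] ∑[ y < n ] ⟦ + q ∣? curve u c a b (+ x) (+ y) ⟧

module _ (m n q : ℕ) (u c a b : ℤ) where

  private
    shift-∣ : ∀ {k} t r → q ℕ∣.∣ k → + q ∣ + (t ℕ.* k ℕ.+ r) - + r
    shift-∣ {k} t r q∣k = subst (+ q ∣_) (begin
      + t * + k          ≡⟨ identity (+ t * + k) (+ r) ⟩
      + t * + k + + r - + r ≡⟨ cong (λ z → z + + r - + r) (sym (ℤ.pos-* t k)) ⟩
      + (t ℕ.* k) + + r - + r ≡⟨ cong (_- + r) (sym (ℤ.pos-+ (t ℕ.* k) r)) ⟩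
      + (t ℕ.* k ℕ.+ r) - + r ∎) (∣n⇒∣m*n (+ t) (∣ᵤ⇒∣ q∣k))
      where
      open ≡-Reasoning
      identity : ∀ z r → z ≡ z + r - r
      identity = solve-∀

  zeros-periodic-x : ∀ s → q ℕ∣.∣ m → zeros (s ℕ.* m) n q u c a b ≡ s ℕ.* zeros m n q u c a b
  zeros-periodic-x s q∣m = ∑-periodic s m λ t r → ∑-cong n λ y _ → ⟦∣⟧-congruent q
    (curve u c a b (+ (t ℕ.* m ℕ.+ r)) (+ y)) (curve u c a b (+ r) (+ y))
    (subst (+ q ∣_) (sym (curve-Δx u c a b (+ (t ℕ.* m ℕ.+ r)) (+ r) (+ y)))
      (∣m⇒∣m*n _ (shift-∣ t r q∣m)))

  zeros-periodic-y : ∀ s → q ℕ∣.∣ n → zeros m (s ℕ.* n) q u c a b ≡ s ℕ.* zeros m n q u c a b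
  zeros-periodic-y s q∣n = trans
    (∑-cong m λ x _ → ∑-periodic s n λ t r → ⟦∣⟧-congruent q
      (curve u c a b (+ x) (+ (t ℕ.* n ℕ.+ r))) (curve u c a b (+ x) (+ r))
      (subst (+ q ∣_) (sym (curve-Δy u c a b (+ x) (+ (t ℕ.* n ℕ.+ r)) (+ r)))
        (∣m⇒∣m*n _ (shift-∣ t r q∣n))))
    (∑-*ˡ m s _)

  zeros-none : (∀ x y → ¬ + q ∣ curve u c a b x y) → zeros m n q u c a b ≡ 0
  zeros-none none = ∑-zero m λ x _ → ∑-zero n λ y _ → ⟦⟧-false (+ q ∣? _) (none (+ x) (+ y))

  module _ (p : ℕ) .{{_ : NonZero p}} where

    -- Terms with `x` prime to `p` vanish by hypothesis; for the others `x = p X` moves `p ^ 3` into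
    -- `c` and `p` into `a`.
    zeros-multiples-x : (∀ x y → + q ∣ curve u c a b x y → + p ∣ x) →
      zeros (p ℕ.* m) n q u c a b ≡ zeros m n q u (+ p * (+ p * (+ p * c))) (+ p * a) b
    zeros-multiples-x q∣⇒p∣x = trans
      (∑-multiples p m λ x p∤x → ∑-zero n λ y _ →
        ⟦⟧-false (+ q ∣? _) λ q∣ → p∤x (∣⇒∣ᵤ (q∣⇒p∣x (+ x) (+ y) q∣)))
      (∑-cong m λ x _ → ∑-cong n λ y _ → cong (λ z → ⟦ + q ∣? z ⟧)
        (trans (cong (λ z → curve u c a b z (+ y)) (ℤ.pos-* p x))
          (identity (+ p) u c a b (+ x) (+ y))))
      where
      identity : ∀ p u c a b x y →
        c * ((p * x) * (p * x) * (p * x)) + a * (p * x) + b - u * (y * y)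
          ≡ p * (p * (p * c)) * (x * x * x) + p * a * x + b - u * (y * y)
      identity = solve-∀

    zeros-multiples-y : (∀ x y → + q ∣ curve u c a b x y → + p ∣ y) →
      zeros m (p ℕ.* n) q u c a b ≡ zeros m n q (+ p * (+ p * u)) c a b
    zeros-multiples-y q∣⇒p∣y = ∑-cong m λ x _ → trans
      (∑-multiples p n λ y p∤y →
        ⟦⟧-false (+ q ∣? _) λ q∣ → p∤y (∣⇒∣ᵤ (q∣⇒p∣y (+ x) (+ y) q∣)))
      (∑-cong n λ y _ → cong (λ z → ⟦ + q ∣? z ⟧)
        (trans (cong (curve u c a b (+ x)) (ℤ.pos-* p y)) (identity (+ p) u c a b (+ x) (+ y))))
      where
      identity : ∀ p u c a b x y →
        c * (x * x * x) + a * x + b - u * ((p * y) * (p * y))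
          ≡ c * (x * x * x) + a * x + b - p * (p * u) * (y * y)
      identity = solve-∀

    curve-*ˡ : ∀ x y →
      curve (+ p * u) (+ p * c) (+ p * a) (+ p * b) x y ≡ + p * curve u c a b x y
    curve-*ˡ x y = identity (+ p) u c a b x y
      where
      identity : ∀ p u c a b x y →
        p * c * (x * x * x) + p * a * x + p * b - p * u * (y * y)
          ≡ p * (c * (x * x * x) + a * x + b - u * (y * y))
      identity = solve-∀

    -- The box keeps its sides, so a box that was one period long may now span `p` periods.
    zeros-cancel : zeros m n (p ℕ.* q) (+ p * u) (+ p * c) (+ p * a) (+ p * b) ≡ zeros m n q u c a b
    zeros-cancel = ∑-cong m λ x _ → ∑-cong n λ y _ → ⟦⟧-cong (_ ∣? _) (_ ∣? _)
      (λ pq∣ → *-cancelˡ-∣ (+ p) (subst₂ _∣_ (ℤ.pos-* p q) (curve-*ˡ (+ x) (+ y)) pq∣))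
      (λ q∣ → subst₂ _∣_ (sym (ℤ.pos-* p q)) (sym (curve-*ˡ (+ x) (+ y))) (*-monoʳ-∣ (+ p) q∣))

-- Bounded search for the greatest number with a property

module _ {P : ℕ → Set} (P? : Decidable P) where

  -- The search falls back on `0` without testing it, hence the hypothesis `P 0`.
  greatest-holds : P 0 → ∀ n → P (greatest P? n)
  greatest-holds p₀ zero = p₀
  greatest-holds p₀ (suc n) with P? (suc n)
  ... | yes p = p
  ... | no  _ = greatest-holds p₀ n

  greatest-maximal : ∀ {n e} → e ≤ n → P e → e ≤ greatest P? n
  greatest-maximal {zero}  e≤0 p = e≤0
  greatest-maximal {suc n} e≤1+n p with P? (suc n)
  ... | yes _  = e≤1+n
  ... | no  ¬p = greatest-maximal (ℕ.s≤s⁻¹ (ℕ.≤∧≢⇒< e≤1+n λ { refl → ¬p p })) p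

-- The eight rows

-- The stronger bound is written as a sum so that unification finds `d` when both bounds are
-- numerals.
weaken : ∀ m {d α} → [ m ℕ.+ d ] ≤⁺ α → [ m ] ≤⁺ α
weaken m = ≤⁺-trans ℕ.≤-trans [ ℕ.m≤m+n m _ ]

≡⇒≤⁺ : ∀ {e α} → α ≡ [ e ] → [ e ] ≤⁺ α
≡⇒≤⁺ refl = [ ℕ.≤-refl ]

≤⁺-split : ∀ e {α} → [ e ] ≤⁺ α → (α ≡ [ e ]) ⊎ ([ suc e ] ≤⁺ α)
≤⁺-split e (_ ≤⊤⁺)  = inj₂ (_ ≤⊤⁺)
≤⁺-split e [ e≤a ] with ℕ.m≤n⇒m<n∨m≡n e≤a
... | inj₁ e<a  = inj₂ [ e<a ]
... | inj₂ refl = inj₁ refl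

-- The rows are the outcomes of a decision list with the tests β = 1, α = 1, β = 2, (α = 2 or β =
-- 3), β = 4, α = 3, β = 5; each failed test raises the lower bounds it concerns by one.
row-exists : ∀ {α β} → [ 1 ] ≤⁺ α → [ 1 ] ≤⁺ β → ∃ λ r → Applies r α β
row-exists 1≤α 1≤β with ≤⁺-split 1 1≤β
... | inj₁ β≡1 = row1 , β≡1
... | inj₂ 2≤β with ≤⁺-split 1 1≤α
... | inj₁ α≡1 = row2 , α≡1 , 2≤β
... | inj₂ 2≤α with ≤⁺-split 2 2≤β
... | inj₁ β≡2 = row3 , 2≤α , β≡2
... | inj₂ 3≤β with ≤⁺-split 2 2≤α | ≤⁺-split 3 3≤β
... | inj₁ α≡2 | _        = row4 , 2≤α , 3≤β , inj₁ α≡2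
... | inj₂ _   | inj₁ β≡3 = row4 , 2≤α , 3≤β , inj₂ β≡3
... | inj₂ 3≤α | inj₂ 4≤β with ≤⁺-split 4 4≤β
... | inj₁ β≡4 = row5 , 3≤α , β≡4
... | inj₂ 5≤β with ≤⁺-split 3 3≤α
... | inj₁ α≡3 = row6 , α≡3 , 5≤β
... | inj₂ 4≤α with ≤⁺-split 5 5≤β
... | inj₁ β≡5 = row7 , 4≤α , β≡5
... | inj₂ 6≤β = row8 , 4≤α , 6≤β

private
  -- Matching a bound with such a pattern exposes enough successors for `classify` to compute.
  pattern 2≤ n = s≤s (s≤s (z≤n {n}))
  pattern 3≤ n = s≤s (2≤ n)
  pattern 4≤ n = s≤s (3≤ n)
  pattern 5≤ n = s≤s (4≤ n)
  pattern 6≤ n = s≤s (5≤ n)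

-- The decision list of `row-exists` as a function: two applicable rows are equal because both equal
-- its value. No row applies where the clauses with `[ 0 ]` are reached.
classify : (α β : ℕ ⁺) → Row
classify α        [ 0 ]    = row1
classify α        [ 1 ]    = row1
classify [ 0 ]    β        = row2
classify [ 1 ]    β        = row2
classify α        [ 2 ]    = row3
classify [ 2 ]    β        = row4
classify α        [ 3 ]    = row4
classify α        [ 4 ]    = row5
classify [ 3 ]    β        = row6
classify α        [ 5 ]    = row7
classify α        β        = row8

row-unique : ∀ r {α β} → Applies r α β → classify α β ≡ r
row-unique row1 refl = refl
row-unique row2 (refl , [ 2≤ _ ]) = refl
row-unique row2 (refl , (_ ≤⊤⁺))    = refl
row-unique row3 ([ 2≤ _ ] , refl) = refl
row-unique row3 ((_ ≤⊤⁺)    , refl) = refl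
row-unique row4 (_ , [ 3≤ _ ] , inj₁ refl) = refl
row-unique row4 (_ , (_ ≤⊤⁺) , inj₁ refl) = refl
-- The cases α = 2 and α > 2 reach different clauses of `classify`.
row-unique row4 ([ 2≤ 0 ] , _ , inj₂ refl) = refl
row-unique row4 ([ 2≤ (suc _) ] , _ , inj₂ refl) = refl
row-unique row4 ((_ ≤⊤⁺)    , _ , inj₂ refl) = refl
row-unique row5 ([ 3≤ _ ] , refl) = refl
row-unique row5 ((_ ≤⊤⁺)    , refl) = refl
row-unique row6 (refl , [ 5≤ _ ]) = refl
row-unique row6 (refl , (_ ≤⊤⁺))    = refl
row-unique row7 ([ 4≤ _ ] , refl) = refl
row-unique row7 ((_ ≤⊤⁺)    , refl) = refl
row-unique row8 ([ 4≤ _ ] , [ 6≤ _ ]) = refl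
row-unique row8 ([ 4≤ _ ] , (_ ≤⊤⁺))    = refl
row-unique row8 ((_ ≤⊤⁺)    , [ 6≤ _ ]) = refl
row-unique row8 ((_ ≤⊤⁺)    , (_ ≤⊤⁺))    = refl

-- These are the bounds that `M-initial` asks for at `k = h r ∸ 1`, the last exponent below the
-- threshold.
lower-bounds : ∀ r {α β} → [ 1 ] ≤⁺ α → [ 1 ] ≤⁺ β → Applies r α β →
  ([ (h r ℕ.∸ 2) ℕ.⊓ 3 ] ≤⁺ α) × ([ h r ℕ.∸ 1 ] ≤⁺ β)
lower-bounds row1 1≤α 1≤β _               = weaken 0 1≤α , 1≤β
lower-bounds row2 1≤α 1≤β _               = weaken 0 1≤α , 1≤β
lower-bounds row3 1≤α 1≤β (_ , β≡2)       = 1≤α , ≡⇒≤⁺ β≡2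
lower-bounds row4 1≤α 1≤β (2≤α , 3≤β , _) = 2≤α , 3≤β
lower-bounds row5 1≤α 1≤β (3≤α , β≡4)     = 3≤α , ≡⇒≤⁺ β≡4
lower-bounds row6 1≤α 1≤β (α≡3 , 5≤β)     = ≡⇒≤⁺ α≡3 , weaken 4 5≤β
lower-bounds row7 1≤α 1≤β (4≤α , β≡5)     = weaken 3 4≤α , ≡⇒≤⁺ β≡5
lower-bounds row8 1≤α 1≤β (4≤α , 6≤β)     = weaken 3 4≤α , weaken 5 6≤β

-- Counting modulo powers of an odd prime

module OddPrime (p : ℕ) (p-prime : Prime p) (2<p : 2 < p) where

  private instance
    p-nonZero : NonZero p
    p-nonZero = prime⇒nonZero p-prime

  -- The valuation and exact powers of `p`

  n<p^n : ∀ n → n < p ^ n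
  n<p^n zero    = z<s
  n<p^n (suc n) = ℕ.≤-<-trans (n<p^n n)
    (subst (p ^ n <_) (ℕ.*-comm (p ^ n) p)
      (ℕ.m<m*n (p ^ n) p {{ℕ.m^n≢0 p n}} (ℕ.<-trans (s<s z<s) 2<p)))

  ^-monoʳ-∣ : ∀ {m n} → m ≤ n → p ^ m ℕ∣.∣ p ^ n
  ^-monoʳ-∣ {m} {n} m≤n = subst (λ k → p ^ m ℕ∣.∣ p ^ k) (ℕ.m+[n∸m]≡n m≤n)
    (subst (p ^ m ℕ∣.∣_) (sym (ℕ.^-distribˡ-+-* p m (n ℕ.∸ m))) (ℕ∣.m∣m*n (p ^ (n ℕ.∸ m))))

  ^∣⇒≤v : ∀ e z → + (p ^ e) ∣ z → [ e ] ≤⁺ v p z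
  ^∣⇒≤v e z p^e∣z with z ℤ.≟ 0ℤ
  ... | yes _   = _ ≤⊤⁺
  ... | no  z≢0 = [ greatest-maximal (λ e → + (p ^ e) ∣? z) (ℕ.<⇒≤ (ℕ.<-≤-trans (n<p^n e)
                      (ℕ∣.∣⇒≤ {{≢-nonZero z≢0}} (∣⇒∣ᵤ p^e∣z)))) p^e∣z ]

  ≤v⇒^∣ : ∀ e z → [ e ] ≤⁺ v p z → + (p ^ e) ∣ z
  ≤v⇒^∣ e z e≤v with z ℤ.≟ 0ℤ
  ≤v⇒^∣ e z e≤v     | yes refl = divides 0ℤ refl
  ≤v⇒^∣ e z [ e≤v ] | no  _    = ∣-trans (∣ᵤ⇒∣ (^-monoʳ-∣ e≤v))
    (greatest-holds (λ e → + (p ^ e) ∣? z) (divides z (sym (ℤ.*-identityʳ z))) ∣ z ∣)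

  -- The factors are nested so that a coefficient `scale (suc e) z` has the form `+ p * _` of the
  -- descent lemmas by computation.
  scale : ℕ → ℤ → ℤ
  scale zero    z = z
  scale (suc e) z = + p * scale e z

  scale-^ : ∀ e z → scale e z ≡ z * + (p ^ e)
  scale-^ zero    z = sym (ℤ.*-identityʳ z)
  scale-^ (suc e) z = begin
    + p * scale e z         ≡⟨ cong (+ p *_) (scale-^ e z) ⟩
    + p * (z * + (p ^ e))   ≡⟨ identity (+ p) z (+ (p ^ e)) ⟩
    z * (+ p * + (p ^ e))   ≡⟨ cong (z *_) (sym (ℤ.pos-* p (p ^ e))) ⟩
    z * + (p ^ suc e)       ∎
    where
    open ≡-Reasoning
    identity : ∀ p z q → p * (z * q) ≡ z * (p * q)
    identity = solve-∀

  -- The remainder is below `p ^ e` and divisible by it, hence `0`, so rounding down loses nothing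
  -- and `p ^ e` can be cancelled.
  quot-scale : ∀ e z → quot p (scale e z) e ≡ z
  quot-scale e z = ℤ.*-cancelʳ-≡ _ z (+ n) (begin
    q * + n                                ≡⟨ ℤ.+-identityˡ (q * + n) ⟨
    0ℤ + q * + n                           ≡⟨ cong (λ r → + r + q * + n) remainder≡0 ⟨
    + (scale e z %ℕ n) + q * + n           ≡⟨ a≡a%ℕn+[a/ℕn]*n (scale e z) n ⟨
    scale e z                              ≡⟨ scale-^ e z ⟩
    z * + n                                ∎)
    where
    open ≡-Reasoning
    n = p ^ e
    instance
      n-nonZero : NonZero n
      n-nonZero = ℕ.m^n≢0 p e
    q = scale e z /ℕ n
    remainder≡0 : scale e z %ℕ n ≡ 0
    remainder≡0 = residue-≡ (n%ℕd<d (scale e z) n) (ℕ.>-nonZero⁻¹ n)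
      (divides (z - q) (begin
        r - 0ℤ ≡⟨ identity r (q * + n) ⟩
        r + q * + n - q * + n  ≡⟨ cong (_- q * + n) (a≡a%ℕn+[a/ℕn]*n (scale e z) n) ⟨
        scale e z - q * + n     ≡⟨ cong (_- q * + n) (scale-^ e z) ⟩
        z * + n - q * + n       ≡⟨ factor z q (+ n) ⟩
        (z - q) * + n           ∎))
      where
      r = + (scale e z %ℕ n)
      identity : ∀ r s → r - 0ℤ ≡ r + s - s
      identity = solve-∀
      factor : ∀ z q n → z * n - q * n ≡ (z - q) * n
      factor = solve-∀

  ≤v⇒scale : ∀ e z → [ e ] ≤⁺ v p z → ∃ λ z′ → z ≡ scale e z′
  ≤v⇒scale e z e≤v with divides z′ z≡ ← ≤v⇒^∣ e z e≤v = z′ , trans z≡ (sym (scale-^ e z′))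

  -- If `p` divided the cofactor, then `p ^ suc e` would divide `z` and the valuation would exceed
  -- `e`.
  v≡⇒scale : ∀ e z → v p z ≡ [ e ] → ∃ λ z′ → z ≡ scale e z′ × ¬ + p ∣ z′
  v≡⇒scale e z v≡e with ≤v⇒scale e z (subst ([ e ] ≤⁺_) (sym v≡e) [ ℕ.≤-refl ])
  ... | z′ , refl = z′ , refl , λ p∣z′ → ℕ.1+n≰n ([≤]-injective (subst ([ suc e ] ≤⁺_) v≡e
          (^∣⇒≤v (suc e) (scale e z′) (subst₂ _∣_ (sym (ℤ.pos-* p (p ^ e))) (sym (scale-^ e z′))
            (*-monoˡ-∣ (+ (p ^ e)) p∣z′)))))

  -- Divisibility by `p` and by its powers

  euclid : ∀ x y → + p ∣ x * y → (+ p ∣ x) ⊎ (+ p ∣ y)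
  euclid x y p∣xy with euclidsLemma ∣ x ∣ ∣ y ∣ p-prime (subst (p ℕ∣.∣_) (ℤ.abs-* x y) (∣⇒∣ᵤ p∣xy))
  ... | inj₁ p∣x = inj₁ (∣ᵤ⇒∣ p∣x)
  ... | inj₂ p∣y = inj₂ (∣ᵤ⇒∣ p∣y)

  euclidʳ : ∀ {x y} → ¬ + p ∣ x → + p ∣ x * y → + p ∣ y
  euclidʳ {x} {y} p∤x p∣xy = [ (λ p∣x → contradiction p∣x p∤x) , id ]′ (euclid x y p∣xy)

  p∣square⇒p∣ : ∀ y → + p ∣ y * y → + p ∣ y
  p∣square⇒p∣ y = [ id , id ]′ ∘ euclid y y

  p∣cube⇒p∣ : ∀ x → + p ∣ x * x * x → + p ∣ x
  p∣cube⇒p∣ x = [ p∣square⇒p∣ x , id ]′ ∘ euclid (x * x) x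

  p∤1 : ¬ + p ∣ 1ℤ
  p∤1 p∣1 = ℕ.<⇒≱ 2<p (ℕ.≤-trans (ℕ∣.∣⇒≤ (∣⇒∣ᵤ p∣1)) (s≤s z≤n))

  p∤2 : ¬ + p ∣ + 2
  p∤2 p∣2 = ℕ.<⇒≱ 2<p (ℕ∣.∣⇒≤ (∣⇒∣ᵤ p∣2))

  p∣p* : ∀ z → + p ∣ + p * z
  p∣p* z = ∣m⇒∣m*n z ∣-refl

  p∣p^ : ∀ j {z} → + (p ^ suc j) ∣ z → + p ∣ z
  p∣p^ j = ∣-trans (∣ᵤ⇒∣ (ℕ∣.m∣m*n (p ^ j)))

  -- Induction on `j`: Euclid's lemma extracts one factor `p` from `z`, which is cancelled on both
  -- sides.
  ^∣-cancelʳ : ∀ {w} → ¬ + p ∣ w → ∀ j z → + (p ^ j) ∣ z * w → + (p ^ j) ∣ z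
  ^∣-cancelʳ p∤w zero    z _ = divides z (sym (ℤ.*-identityʳ z))
  ^∣-cancelʳ {w} p∤w (suc j) z p^∣zw
    with divides z′ refl ← euclidʳ p∤w (subst (+ p ∣_) (ℤ.*-comm z w) (p∣p^ j p^∣zw)) =
    subst₂ _∣_ (sym (ℤ.pos-* p (p ^ j))) (ℤ.*-comm (+ p) z′) (*-monoʳ-∣ (+ p)
      (^∣-cancelʳ p∤w j z′ (*-cancelˡ-∣ (+ p)
        (subst₂ _∣_ (ℤ.pos-* p (p ^ j)) (identity z′ (+ p) w) p^∣zw))))
    where
    identity : ∀ z p w → z * p * w ≡ p * (z * w)
    identity = solve-∀

  -- Hensel's lemma: when the difference quotient of f is a unit everywhere, f is injective modulo
  -- p ^ j, hence bijective by pigeonhole.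
  ∑-hensel : (f : ℤ → ℤ) (w : ℤ → ℤ → ℤ) → (∀ x y → f x - f y ≡ (x - y) * w x y) →
    (∀ x y → ¬ + p ∣ w x y) → ∀ j → ∑[ x < p ^ j ] ⟦ + (p ^ j) ∣? f (+ x) ⟧ ≡ 1
  ∑-hensel f w f-Δ p∤w j = ∑-unique-zero (p ^ j) {{ℕ.m^n≢0 p j}} f
    λ x y p^j∣ → ^∣-cancelʳ (p∤w x y) j (x - y) (subst (+ (p ^ j) ∣_) (f-Δ x y) p^j∣)

  -- Square roots of units modulo `p` and modulo its powers

  -- The factor 1ℤ makes the argument of ∣? an instance of curve 1ℤ.
  roots : ℤ → ℕ
  roots d = ∑[ y < p ] ⟦ + p ∣? d - 1ℤ * (+ y * + y) ⟧

  roots-congruent : ∀ d d′ → + p ∣ d - d′ → roots d ≡ roots d′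
  roots-congruent d d′ p∣ = ∑-cong p λ y _ →
    ⟦∣⟧-congruent p (d - 1ℤ * (+ y * + y)) (d′ - 1ℤ * (+ y * + y))
    (subst (+ p ∣_) (identity d d′ (+ y)) p∣)
    where
    identity : ∀ d d′ y → d - d′ ≡ d - 1ℤ * (y * y) - (d′ - 1ℤ * (y * y))
    identity = solve-∀

  ∑-linear : ∀ e → ∑[ x < p ] ⟦ + p ∣? (+ x - e) ⟧ ≡ 1
  ∑-linear e = ∑-unique-zero p (_- e) λ x y → subst (+ p ∣_) (identity x y e)
    where
    identity : ∀ x y e → x - e - (y - e) ≡ x - y
    identity = solve-∀

  -- If `r` is a root, then `y² - d ≡ (y - r)(y + r)`, so the roots are `r` and `- r`; they differ
  -- because `p` divides neither `2` nor `r`. If there is no root, both sides are `0`.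
  roots-χ : ∀ {d} → ¬ + p ∣ d → + roots d ≡ 1ℤ + χ p d
  roots-χ {d} p∤d rewrite dec-false (+ p ∣? d) p∤d
    with any? {n = p} (λ x → rep x ^ℤ 2 ≈? d [mod p ])
  ... | no  none = cong +_ (∑-zero p λ y y<p → ⟦⟧-false (+ p ∣? _) λ p∣ → none (fromℕ< y<p ,
          subst (λ k → + p ∣ (+ k) ^ℤ 2 - d) (sym (toℕ-fromℕ< y<p))
            (subst (+ p ∣_) (identity d (+ y)) (∣m⇒∣-m p∣))))
    where
    identity : ∀ d y → - (d - 1ℤ * (y * y)) ≡ y * (y * 1ℤ) - d
    identity = solve-∀
  ... | yes (y₀ , p∣y₀²-d) = cong +_ (begin
    roots d
      ≡⟨ ∑-cong p (λ y _ → ⟦⟧-⊎ (+ p ∣? d - 1ℤ * (+ y * + y)) (+ p ∣? + y - r) (+ p ∣? + y - - r)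
           (λ p∣ → euclid (+ y - r) (+ y - - r)
             (subst (+ p ∣_) (split d (+ y) r) (∣m⇒∣-m (∣m∣n⇒∣m+n p∣ p∣y₀²-d))))
           (λ p∣ → subst (+ p ∣_) (merge₁ d (+ y) r)
             (∣m⇒∣-m (∣m∣n⇒∣m+n (∣m⇒∣m*n (+ y + r) p∣) p∣y₀²-d)))
           (λ p∣ → subst (+ p ∣_) (merge₂ d (+ y) r)
             (∣m⇒∣-m (∣m∣n⇒∣m+n (∣m⇒∣m*n (+ y - r) p∣) p∣y₀²-d)))
           (λ (p∣₁ , p∣₂) → p∤r (euclidʳ p∤2
             (subst (+ p ∣_) (difference (+ y) r) (∣m∣n⇒∣m-n p∣₂ p∣₁))))) ⟩
    (∑[ y < p ] ⟦ + p ∣? + y - r ⟧ ℕ.+ ⟦ + p ∣? + y - - r ⟧)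
      ≡⟨ ∑-+ p _ _ ⟩
    (∑[ y < p ] ⟦ + p ∣? + y - r ⟧) ℕ.+ (∑[ y < p ] ⟦ + p ∣? + y - - r ⟧)
      ≡⟨ cong₂ ℕ._+_ (∑-linear r) (∑-linear (- r)) ⟩
    2 ∎)
    where
    open ≡-Reasoning
    r = rep y₀

    p∤r : ¬ + p ∣ r
    p∤r p∣r = p∤d (∣-congruent p∣y₀²-d (∣m⇒∣m*n _ p∣r))

    split : ∀ d y r → - (d - 1ℤ * (y * y) + (r * (r * 1ℤ) - d)) ≡ (y - r) * (y - - r)
    split = solve-∀
    merge₁ : ∀ d y r → - ((y - r) * (y + r) + (r * (r * 1ℤ) - d)) ≡ d - 1ℤ * (y * y)
    merge₁ = solve-∀
    merge₂ : ∀ d y r → - ((y - - r) * (y - r) + (r * (r * 1ℤ) - d)) ≡ d - 1ℤ * (y * y)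
    merge₂ = solve-∀
    difference : ∀ y r → y - - r - (y - r) ≡ + 2 * r
    difference = solve-∀

  -- Write `y = t p + r`. By Hensel's lemma in `t`, a root `r` modulo `p` lifts to exactly one root
  -- modulo `p ^ suc j`; any other residue lifts to none.
  roots-lift : ∀ j {d} → ¬ + p ∣ d →
    ∑[ y < p ^ suc j ] ⟦ + (p ^ suc j) ∣? d - 1ℤ * (+ y * + y) ⟧ ≡ roots d
  roots-lift j {d} p∤d = begin
    (∑[ y < p ^ suc j ] g (+ y))
      ≡⟨ cong (λ n → ∑[ y < n ] g (+ y)) (ℕ.*-comm p (p ^ j)) ⟩
    (∑[ y < p ^ j ℕ.* p ] g (+ y))
      ≡⟨ ∑-blocks (p ^ j) p _ ⟩
    (∑[ t < p ^ j ] ∑[ r < p ] g (+ (t ℕ.* p ℕ.+ r)))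
      ≡⟨ ∑-swap (p ^ j) p _ ⟩
    (∑[ r < p ] ∑[ t < p ^ j ] g (+ (t ℕ.* p ℕ.+ r)))
      ≡⟨ ∑-cong p (λ r _ → lifts r) ⟩
    roots d
      ∎
    where
    open ≡-Reasoning
    g : ℤ → ℕ
    g y = ⟦ + (p ^ suc j) ∣? d - 1ℤ * (y * y) ⟧

    pos-block : ∀ t r → + (t ℕ.* p ℕ.+ r) ≡ + t * + p + + r
    pos-block t r = trans (ℤ.pos-+ (t ℕ.* p) r) (cong (_+ + r) (ℤ.pos-* t p))

    lifts : ∀ r → ∑[ t < p ^ j ] g (+ (t ℕ.* p ℕ.+ r)) ≡ ⟦ + p ∣? d - 1ℤ * (+ r * + r) ⟧
    lifts r with + p ∣? d - 1ℤ * (+ r * + r)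
    ... | no p∤ = trans (∑-zero (p ^ j) λ t _ → ⟦⟧-false (+ (p ^ suc j) ∣? _) λ p^∣ →
      p∤ (∣-congruent {z = d - 1ℤ * (+ (t ℕ.* p ℕ.+ r) * + (t ℕ.* p ℕ.+ r))}
        (subst (+ p ∣_)
          (trans (reduce (+ p) d (+ t) (+ r))
            (cong (λ y → d - 1ℤ * (y * y) - (d - 1ℤ * (+ r * + r))) (sym (pos-block t r))))
          (p∣p* _))
        (p∣p^ j p^∣)))
      (sym (⟦⟧-false (+ p ∣? _) p∤))
      where
      reduce : ∀ p d t r → p * (- (t * (t * p + + 2 * r))) ≡
        d - 1ℤ * ((t * p + r) * (t * p + r)) - (d - 1ℤ * (r * r))
      reduce = solve-∀
    ... | yes p∣@(divides e d-r²≡ep) = trans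
      (∑-cong (p ^ j) λ t _ → ⟦⟧-cong (_ ∣? _) (+ (p ^ j) ∣? f (+ t))
        (λ p^∣ → *-cancelˡ-∣ (+ p) (subst₂ _∣_ (ℤ.pos-* p (p ^ j)) (factor t) p^∣))
        (λ p^∣ → subst₂ _∣_ (sym (ℤ.pos-* p (p ^ j))) (sym (factor t)) (*-monoʳ-∣ (+ p) p^∣)))
      (trans (∑-hensel f w (f-Δ e (+ p) (+ r)) p∤w j) (sym (⟦⟧-true (+ p ∣? _) p∣)))
      where
      -- With `d - r² = e p`, this is `d - (t p + r)²` divided by `p`. Its difference quotient `w`
      -- is congruent to `- 2 r` modulo `p`, a unit.
      f : ℤ → ℤ
      f t = e - + 2 * + r * t - + p * (t * t)
      w : ℤ → ℤ → ℤ
      w t t′ = - (+ 2 * + r) - + p * (t + t′)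

      f-Δ : ∀ e p r t t′ → e - + 2 * r * t - p * (t * t) - (e - + 2 * r * t′ - p * (t′ * t′)) ≡
        (t - t′) * (- (+ 2 * r) - p * (t + t′))
      f-Δ = solve-∀

      p∤r : ¬ + p ∣ + r
      p∤r p∣r = p∤d (subst (+ p ∣_) (identity d (+ r)) (∣m∣n⇒∣m+n p∣ (∣m⇒∣m*n (+ r) p∣r)))
        where
        identity : ∀ d r → d - 1ℤ * (r * r) + r * r ≡ d
        identity = solve-∀

      p∤w : ∀ t t′ → ¬ + p ∣ w t t′
      p∤w t t′ p∣w = p∤r (euclidʳ p∤2 (subst (+ p ∣_) (identity (+ p) (+ r) t t′)
        (∣m⇒∣-m (∣m∣n⇒∣m+n p∣w (p∣p* (t + t′))))))
        where
        identity : ∀ p r t t′ → - (- (+ 2 * r) - p * (t + t′) + p * (t + t′)) ≡ + 2 * r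
        identity = solve-∀

      factor : ∀ t → d - 1ℤ * (+ (t ℕ.* p ℕ.+ r) * + (t ℕ.* p ℕ.+ r)) ≡ + p * f (+ t)
      factor t = begin
        d - 1ℤ * (+ (t ℕ.* p ℕ.+ r) * + (t ℕ.* p ℕ.+ r))
          ≡⟨ cong (λ y → d - 1ℤ * (y * y)) (pos-block t r) ⟩
        d - 1ℤ * ((+ t * + p + + r) * (+ t * + p + + r))
          ≡⟨ expand (+ p) d (+ t) (+ r) ⟩
        d - 1ℤ * (+ r * + r) - + p * (+ 2 * + r * + t + + p * (+ t * + t))
          ≡⟨ cong (_- + p * (+ 2 * + r * + t + + p * (+ t * + t))) d-r²≡ep ⟩
        e * + p - + p * (+ 2 * + r * + t + + p * (+ t * + t))
          ≡⟨ collect (+ p) e (+ t) (+ r) ⟩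
        + p * f (+ t)
          ∎
        where
        expand : ∀ p d t r → d - 1ℤ * ((t * p + r) * (t * p + r)) ≡
          d - 1ℤ * (r * r) - p * (+ 2 * r * t + p * (t * t))
        expand = solve-∀
        collect : ∀ p e t r → e * p - p * (+ 2 * r * t + p * (t * t)) ≡
          p * (e - + 2 * r * t - p * (t * t))
        collect = solve-∀

  -- Descent for zeros modulo powers of `p`

  Z : ℕ → (u c a b : ℤ) → ℕ
  Z j = zeros (p ^ j) (p ^ j) (p ^ j)

  Z-zero : ∀ u c a b → Z 0 u c a b ≡ 1
  Z-zero u c a b = cong (λ n → n ℕ.+ 0 ℕ.+ 0)
    (⟦⟧-true (1ℤ ∣? curve u c a b 0ℤ 0ℤ) (∣ᵤ⇒∣ (ℕ∣.1∣ _)))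

  -- After cancelling `p`, the box spans `p` periods of the modulus `p ^ j` in each direction.
  Z-divide : ∀ j u c a b →
    Z (suc j) (+ p * u) (+ p * c) (+ p * a) (+ p * b) ≡ p ℕ.* (p ℕ.* Z j u c a b)
  Z-divide j u c a b = begin
    Z (suc j) (+ p * u) (+ p * c) (+ p * a) (+ p * b)
      ≡⟨ zeros-cancel (p ^ suc j) (p ^ suc j) (p ^ j) u c a b p ⟩
    zeros (p ^ suc j) (p ^ suc j) (p ^ j) u c a b
      ≡⟨ zeros-periodic-x (p ^ j) (p ^ suc j) (p ^ j) u c a b p ℕ∣.∣-refl ⟩
    p ℕ.* zeros (p ^ j) (p ^ suc j) (p ^ j) u c a b
      ≡⟨ cong (p ℕ.*_) (zeros-periodic-y (p ^ j) (p ^ j) (p ^ j) u c a b p ℕ∣.∣-refl) ⟩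
    p ℕ.* (p ℕ.* Z j u c a b)
      ∎
    where open ≡-Reasoning

  -- Modulo `p` the equation reads `u y² ≡ 0`, so `y = p Y`. This puts `p ^ 2` into `u`, one factor
  -- is cancelled, and `x` is left with `p` periods.
  Z-divide-y : ∀ j {u} c a b → ¬ + p ∣ u →
    Z (suc j) u (+ p * c) (+ p * a) (+ p * b) ≡ p ℕ.* Z j (+ p * u) c a b
  Z-divide-y j {u} c a b p∤u = begin
    Z (suc j) u (+ p * c) (+ p * a) (+ p * b)
      ≡⟨ zeros-multiples-y (p ^ suc j) (p ^ j) (p ^ suc j) u (+ p * c) (+ p * a) (+ p * b) p p∣y ⟩
    zeros (p ^ suc j) (p ^ j) (p ^ suc j) (+ p * (+ p * u)) (+ p * c) (+ p * a) (+ p * b)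
      ≡⟨ zeros-cancel (p ^ suc j) (p ^ j) (p ^ j) (+ p * u) c a b p ⟩
    zeros (p ^ suc j) (p ^ j) (p ^ j) (+ p * u) c a b
      ≡⟨ zeros-periodic-x (p ^ j) (p ^ j) (p ^ j) (+ p * u) c a b p ℕ∣.∣-refl ⟩
    p ℕ.* Z j (+ p * u) c a b
      ∎
    where
    open ≡-Reasoning
    identity : ∀ p u c a b x y →
      p * (c * (x * x * x) + a * x + b) - (p * c * (x * x * x) + p * a * x + p * b - u * (y * y))
        ≡ u * (y * y)
    identity = solve-∀
    p∣y : ∀ x y → + (p ^ suc j) ∣ curve u (+ p * c) (+ p * a) (+ p * b) x y → + p ∣ y
    p∣y x y p^∣ = p∣square⇒p∣ y (euclidʳ p∤u (subst (+ p ∣_) (identity (+ p) u c a b x y)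
      (∣m∣n⇒∣m-n (p∣p* (c * (x * x * x) + a * x + b)) (p∣p^ j p^∣))))

  -- Modulo `p` the equation reads `c x³ ≡ 0`, so `x = p X`. Cancelling one `p` leaves `p ^ 2` in
  -- `c` and one extra `p` in the linear coefficient; `y` is left with `p` periods.
  Z-divide-x : ∀ j u {c} a b → ¬ + p ∣ c →
    Z (suc j) (+ p * u) c (+ p * a) (+ p * b) ≡ p ℕ.* Z j u (+ p * (+ p * c)) (+ p * a) b
  Z-divide-x j u {c} a b p∤c = begin
    Z (suc j) (+ p * u) c (+ p * a) (+ p * b)
      ≡⟨ zeros-multiples-x (p ^ j) (p ^ suc j) (p ^ suc j) (+ p * u) c (+ p * a) (+ p * b) p p∣x ⟩
    zeros (p ^ j) (p ^ suc j) (p ^ suc j)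
      (+ p * u) (+ p * (+ p * (+ p * c))) (+ p * (+ p * a)) (+ p * b)
      ≡⟨ zeros-cancel (p ^ j) (p ^ suc j) (p ^ j) u (+ p * (+ p * c)) (+ p * a) b p ⟩
    zeros (p ^ j) (p ^ suc j) (p ^ j) u (+ p * (+ p * c)) (+ p * a) b
      ≡⟨ zeros-periodic-y (p ^ j) (p ^ j) (p ^ j) u (+ p * (+ p * c)) (+ p * a) b p ℕ∣.∣-refl ⟩
    p ℕ.* Z j u (+ p * (+ p * c)) (+ p * a) b
      ∎
    where
    open ≡-Reasoning
    identity : ∀ p u c a b x y →
      c * (x * x * x) + p * a * x + p * b - p * u * (y * y) - p * (a * x + b - u * (y * y))
        ≡ c * (x * x * x)
    identity = solve-∀
    p∣x : ∀ x y → + (p ^ suc j) ∣ curve (+ p * u) c (+ p * a) (+ p * b) x y → + p ∣ x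
    p∣x x y p^∣ = p∣cube⇒p∣ x (euclidʳ p∤c (subst (+ p ∣_) (identity (+ p) u c a b x y)
      (∣m∣n⇒∣m-n (p∣p^ j p^∣) (p∣p* (a * x + b - u * (y * y))))))

  -- Modulo `p` the curve reduces to the nonzero constant `b`.
  Z-none : ∀ j u c a {b} → ¬ + p ∣ b → Z (suc j) (+ p * u) (+ p * c) (+ p * a) b ≡ 0
  Z-none j u c a {b} p∤b =
    zeros-none (p ^ suc j) (p ^ suc j) (p ^ suc j) (+ p * u) (+ p * c) (+ p * a) b λ x y p^∣ → p∤b (subst (+ p ∣_) (identity (+ p) u c a b x y)
      (∣m∣n⇒∣m-n (p∣p^ j p^∣) (p∣p* (c * (x * x * x) + a * x - u * (y * y)))))
    where
    identity : ∀ p u c a b x y →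
      p * c * (x * x * x) + p * a * x + b - p * u * (y * y)
        - p * (c * (x * x * x) + a * x - u * (y * y)) ≡ b
    identity = solve-∀

  -- For fixed `y` the difference quotient in `x` is congruent to `a` modulo `p`, hence a unit, and
  -- Hensel's lemma gives one `x`.
  Z-unit-a : ∀ j u c {a} b → ¬ + p ∣ a → Z j u (+ p * c) a b ≡ p ^ j
  Z-unit-a j u c {a} b p∤a = begin
    Z j u (+ p * c) a b
      ≡⟨ ∑-swap (p ^ j) (p ^ j) _ ⟩
    (∑[ y < p ^ j ] ∑[ x < p ^ j ] ⟦ + (p ^ j) ∣? curve u (+ p * c) a b (+ x) (+ y) ⟧)
      ≡⟨ ∑-cong (p ^ j) (λ y _ → ∑-hensel (λ x → curve u (+ p * c) a b x (+ y)) w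
           (λ x x′ → curve-Δx u (+ p * c) a b x x′ (+ y)) p∤w j) ⟩
    (∑[ _ < p ^ j ] 1)
      ≡⟨ ∑-const (p ^ j) 1 ⟩
    p ^ j ℕ.* 1
      ≡⟨ ℕ.*-identityʳ (p ^ j) ⟩
    p ^ j
      ∎
    where
    open ≡-Reasoning
    w : ℤ → ℤ → ℤ
    w x x′ = a + + p * c * (x * x + x * x′ + x′ * x′)
    p∤w : ∀ x x′ → ¬ + p ∣ w x x′
    p∤w x x′ p∣w = p∤a (∣m+n∣n⇒∣m p∣w (∣m⇒∣m*n (x * x + x * x′ + x′ * x′) (p∣p* c)))

  -- For fixed `x` the equation is `y² ≡ d x` with `d x ≡ b` modulo `p`, so each `x` admits
  -- `roots b` values of `y`.
  Z-unit-b : ∀ j c a {b} → ¬ + p ∣ b → Z (suc j) 1ℤ (+ p * c) (+ p * a) b ≡ p ^ suc j ℕ.* roots b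
  Z-unit-b j c a {b} p∤b = trans
    (∑-cong (p ^ suc j) λ x _ → trans
      (roots-lift j {d (+ x)} λ p∣d → p∤b (∣-congruent (d≈b (+ x)) p∣d))
      (roots-congruent (d (+ x)) b (d≈b (+ x))))
    (∑-const (p ^ suc j) (roots b))
    where
    d : ℤ → ℤ
    d x = + p * c * (x * x * x) + + p * a * x + b
    identity : ∀ p c a b x → p * (c * (x * x * x) + a * x) ≡ p * c * (x * x * x) + p * a * x + b - b
    identity = solve-∀
    d≈b : ∀ x → + p ∣ d x - b
    d≈b x = subst (+ p ∣_) (identity (+ p) c a b x) (p∣p* (c * (x * x * x) + a * x))

  -- The counts `N`, `K` and `M` as zeros of curves

  -- The convention at `0` agrees with the single pair modulo `1`; otherwise the two polynomials
  -- differ by a sign.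
  N-Z : ∀ j a b → N p j a b ≡ Z j 1ℤ 1ℤ a b
  N-Z zero      a b = sym (Z-zero 1ℤ 1ℤ a b)
  N-Z j@(suc _) a b = #pairs-∑ (p ^ j) _ λ x y → trans
    (cong (λ z → ⟦ + (p ^ j) ∣? z ⟧) (identity a b (rep x) (rep y)))
    (⟦∣⟧-neg (p ^ j) (curve 1ℤ 1ℤ a b (rep x) (rep y)))
    where
    identity : ∀ a b x y → y * (y * 1ℤ) - (x * (x * (x * 1ℤ)) + a * x + b) ≡
      - (1ℤ * (x * x * x) + a * x + b - 1ℤ * (y * y))
    identity = solve-∀

  -- The coefficient `+ p * 1ℤ` is `scale 1 1ℤ`, the form in which `M-step₃` produces it.
  K-Z : ∀ j a b → K p j a b ≡ Z j (+ p * 1ℤ) 1ℤ a b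
  K-Z zero      a b = sym (Z-zero (+ p * 1ℤ) 1ℤ a b)
  K-Z j@(suc _) a b = #pairs-∑ (p ^ j) _ λ x y →
    cong (λ z → ⟦ + (p ^ j) ∣? z ⟧) (identity (+ p) a b (rep x) (rep y))
    where
    identity : ∀ p a b x y → x * (x * (x * 1ℤ)) + a * x + b - p * (y * (y * 1ℤ)) ≡
      1ℤ * (x * x * x) + a * x + b - p * 1ℤ * (y * y)
    identity = solve-∀

  -- The substitution `x = p X`, `y = p Y` shortens both sides to `p ^ j` but leaves the modulus
  -- `p ^ suc j`, so this is not yet a value of `Z`.
  M-zeros : ∀ j A B → M p (suc j) A B ≡
    zeros (p ^ j) (p ^ j) (p ^ suc j) (scale 2 1ℤ) (scale 3 1ℤ) (+ p * A) B
  M-zeros j A B = begin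
    M p (suc j) A B
      ≡⟨ #pairs-∑ (p ^ suc j) _ (λ _ _ → refl) ⟩
    (∑[ x < p ^ suc j ] ∑[ y < p ^ suc j ] ⟦ P? x y ⟧)
      ≡⟨ ∑-multiples p (p ^ j) (λ x p∤x → ∑-zero (p ^ suc j) λ y _ →
           ⟦⟧-false (P? x y) λ (_ , p∣x , _) → p∤x (p∣-0 p∣x)) ⟩
    (∑[ x < p ^ j ] ∑[ y < p ^ suc j ] ⟦ P? (p ℕ.* x) y ⟧)
      ≡⟨ ∑-cong (p ^ j) (λ x _ → ∑-multiples p (p ^ j) λ y p∤y →
           ⟦⟧-false (P? (p ℕ.* x) y) λ (_ , _ , p∣y) → p∤y (p∣-0 p∣y)) ⟩
    (∑[ x < p ^ j ] ∑[ y < p ^ j ] ⟦ P? (p ℕ.* x) (p ℕ.* y) ⟧)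
      ≡⟨ ∑-cong (p ^ j) (λ x _ → ∑-cong (p ^ j) λ y _ → pointwise x y) ⟩
    zeros (p ^ j) (p ^ j) (p ^ suc j) (scale 2 1ℤ) (scale 3 1ℤ) (+ p * A) B
      ∎
    where
    open ≡-Reasoning
    E? : ∀ y x → Dec (y ^ℤ 2 ≈ x ^ℤ 3 + A * x + B [mod p ^ suc j ])
    E? y x = y ^ℤ 2 ≈? x ^ℤ 3 + A * x + B [mod p ^ suc j ]
    P? : ∀ x y → Dec _
    P? x y = E? (+ y) (+ x) ×-dec (+ x ≈? 0ℤ [mod p ]) ×-dec (+ y ≈? 0ℤ [mod p ])

    p∣-0 : ∀ {x} → + p ∣ + x - 0ℤ → p ℕ∣.∣ x
    p∣-0 {x} p∣ = ∣⇒∣ᵤ (subst (+ p ∣_) (ℤ.+-identityʳ (+ x)) p∣)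

    p∣p*-0 : ∀ x → + p ∣ + (p ℕ.* x) - 0ℤ
    p∣p*-0 x = subst (+ p ∣_) (sym (ℤ.+-identityʳ (+ (p ℕ.* x)))) (∣ᵤ⇒∣ (ℕ∣.m∣m*n x))

    identity : ∀ p A B x y →
      (p * y) * ((p * y) * 1ℤ) - ((p * x) * ((p * x) * ((p * x) * 1ℤ)) + A * (p * x) + B) ≡
      - (p * (p * (p * 1ℤ)) * (x * x * x) + p * A * x + B - p * (p * 1ℤ) * (y * y))
    identity = solve-∀

    pointwise : ∀ x y → ⟦ P? (p ℕ.* x) (p ℕ.* y) ⟧ ≡
      ⟦ + (p ^ suc j) ∣? curve (scale 2 1ℤ) (scale 3 1ℤ) (+ p * A) B (+ x) (+ y) ⟧
    pointwise x y = begin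
      ⟦ P? (p ℕ.* x) (p ℕ.* y) ⟧
        ≡⟨ ⟦⟧-cong (P? (p ℕ.* x) (p ℕ.* y)) (E? (+ (p ℕ.* y)) (+ (p ℕ.* x)))
             proj₁ (_, p∣p*-0 x , p∣p*-0 y) ⟩
      ⟦ E? (+ (p ℕ.* y)) (+ (p ℕ.* x)) ⟧
        ≡⟨ cong₂ (λ y x → ⟦ E? y x ⟧) (ℤ.pos-* p y) (ℤ.pos-* p x) ⟩
      ⟦ E? (+ p * + y) (+ p * + x) ⟧
        ≡⟨ cong (λ z → ⟦ + (p ^ suc j) ∣? z ⟧) (identity (+ p) A B (+ x) (+ y)) ⟩
      ⟦ + (p ^ suc j) ∣? - curve (scale 2 1ℤ) (scale 3 1ℤ) (+ p * A) B (+ x) (+ y) ⟧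
        ≡⟨ ⟦∣⟧-neg (p ^ suc j) (curve (scale 2 1ℤ) (scale 3 1ℤ) (+ p * A) B (+ x) (+ y)) ⟩
      ⟦ + (p ^ suc j) ∣? curve (scale 2 1ℤ) (scale 3 1ℤ) (+ p * A) B (+ x) (+ y) ⟧
        ∎

  M-one : ∀ A {B} → + p ∣ B → M p 1 A B ≡ 1
  -- The box is the single point `(0, 0)`, where the curve takes the value `B`.
  M-one A {B} p∣B = trans (M-zeros 0 A B) (cong (λ n → n ℕ.+ 0 ℕ.+ 0)
    (⟦⟧-true (+ (p ^ 1) ∣? curve (scale 2 1ℤ) (scale 3 1ℤ) (+ p * A) B 0ℤ 0ℤ)
      (subst₂ _∣_ (cong +_ (sym (ℕ.*-identityʳ p))) (identity (+ p) A B) p∣B)))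
    where
    identity : ∀ p A B →
      B ≡ p * (p * (p * 1ℤ)) * (0ℤ * 0ℤ * 0ℤ) + p * A * 0ℤ + B - p * (p * 1ℤ) * (0ℤ * 0ℤ)
    identity = solve-∀

  -- Descent for `M`

  M-none : ∀ j a {b} → ¬ + p ∣ b → M p (2 ℕ.+ j) (scale 1 a) (scale 1 b) ≡ 0
  M-none j a {b} p∤b = begin
    M p (2 ℕ.+ j) (scale 1 a) (scale 1 b)
      ≡⟨ M-zeros (suc j) (scale 1 a) (scale 1 b) ⟩
    zeros (p ^ suc j) (p ^ suc j) (p ^ (2 ℕ.+ j)) (scale 2 1ℤ) (scale 3 1ℤ) (scale 2 a) (scale 1 b)
      ≡⟨ zeros-cancel (p ^ suc j) (p ^ suc j) (p ^ suc j)
           (scale 1 1ℤ) (scale 2 1ℤ) (scale 1 a) b p ⟩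
    Z (suc j) (scale 1 1ℤ) (scale 2 1ℤ) (scale 1 a) b
      ≡⟨ Z-none j 1ℤ (scale 1 1ℤ) a p∤b ⟩
    0
      ∎
    where open ≡-Reasoning

  -- The first cancellation makes box and modulus match; all coefficients still contain `p`, so
  -- `Z-divide` applies and yields the factor `p ^ 2`.
  M-step₂ : ∀ j a b → M p (2 ℕ.+ j) (scale 1 a) (scale 2 b) ≡ p ^ 2 ℕ.* Z j 1ℤ (scale 1 1ℤ) a b
  M-step₂ j a b = begin
    M p (2 ℕ.+ j) (scale 1 a) (scale 2 b)
      ≡⟨ M-zeros (suc j) (scale 1 a) (scale 2 b) ⟩
    zeros (p ^ suc j) (p ^ suc j) (p ^ (2 ℕ.+ j)) (scale 2 1ℤ) (scale 3 1ℤ) (scale 2 a) (scale 2 b)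
      ≡⟨ zeros-cancel (p ^ suc j) (p ^ suc j) (p ^ suc j)
           (scale 1 1ℤ) (scale 2 1ℤ) (scale 1 a) (scale 1 b) p ⟩
    Z (suc j) (scale 1 1ℤ) (scale 2 1ℤ) (scale 1 a) (scale 1 b)
      ≡⟨ Z-divide j 1ℤ (scale 1 1ℤ) a b ⟩
    p ℕ.* (p ℕ.* Z j 1ℤ (scale 1 1ℤ) a b)
      ≡⟨ regroup p _ ⟩
    p ^ 2 ℕ.* Z j 1ℤ (scale 1 1ℤ) a b
      ∎
    where
    open ≡-Reasoning
    regroup : ∀ p z → p ℕ.* (p ℕ.* z) ≡ p ℕ.* (p ℕ.* 1) ℕ.* z
    regroup = ℕSolver.solve-∀

  private
    shift : ∀ {m z z′} e → m ≡ p ^ e ℕ.* z → z ≡ p ℕ.* z′ → m ≡ p ^ suc e ℕ.* z′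
    shift {z′ = z′} e refl refl = regroup p (p ^ e) z′
      where
      regroup : ∀ p q z → q ℕ.* (p ℕ.* z) ≡ p ℕ.* q ℕ.* z
      regroup = ℕSolver.solve-∀

  -- From `M-step₂` to `M-step₆` the pair `(u, c)` runs through (1, p), (p, 1), (1, p²), (p, p), (1,
  -- 1): the descent is in `y`, in `x`, in `y`, and finally a division of all coefficients.
  M-step₃ : ∀ j a b → M p (3 ℕ.+ j) (scale 2 a) (scale 3 b) ≡ p ^ 3 ℕ.* Z j (scale 1 1ℤ) 1ℤ a b
  M-step₃ j a b = shift 2 (M-step₂ (suc j) (scale 1 a) (scale 1 b)) (Z-divide-y j 1ℤ a b p∤1)

  M-step₄ : ∀ j a b →
    M p (4 ℕ.+ j) (scale 3 a) (scale 4 b) ≡ p ^ 4 ℕ.* Z j 1ℤ (scale 2 1ℤ) (scale 1 a) b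
  M-step₄ j a b = shift 3 (M-step₃ (suc j) (scale 1 a) (scale 1 b)) (Z-divide-x j 1ℤ a b p∤1)

  -- `M-step₄` has left a factor `p` in the linear coefficient, so only `B` has to supply a new one.
  M-step₅ : ∀ j a b →
    M p (5 ℕ.+ j) (scale 3 a) (scale 5 b) ≡ p ^ 5 ℕ.* Z j (scale 1 1ℤ) (scale 1 1ℤ) a b
  M-step₅ j a b = shift 4 (M-step₄ (suc j) a (scale 1 b)) (Z-divide-y j (scale 1 1ℤ) a b p∤1)

  M-step₆ : ∀ j a b → M p (6 ℕ.+ j) (scale 4 a) (scale 6 b) ≡ p ^ 7 ℕ.* Z j 1ℤ 1ℤ a b
  -- `Z-divide` gains two factors `p`, absorbed one at a time; hence the exponent 7 although the
  -- modulus exponent is `6 + j`.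
  M-step₆ j a b = shift 6
    (shift 5 (M-step₅ (suc j) (scale 1 a) (scale 1 b)) (Z-divide j 1ℤ 1ℤ a b)) refl

  -- The step that reaches `j = 0` at exponent `k` leaves `Z 0`, which is 1. The bound on `A` is the
  -- power of `p` which that step requires. At `k = 6` the step would give `p ^ 7`.
  M-initial : ∀ k A B → 2 ≤ k → k ≤ 5 →
    [ (k ℕ.∸ 1) ℕ.⊓ 3 ] ≤⁺ v p A → [ k ] ≤⁺ v p B → M p k A B ≡ p ^ k
  M-initial k A B 2≤k k≤5 α≥ β≥ with ≤v⇒scale ((k ℕ.∸ 1) ℕ.⊓ 3) A α≥ | ≤v⇒scale k B β≥
  ... | a , refl | b , refl = go k 2≤k k≤5
    where
    unit : ∀ {m z} e → m ≡ p ^ e ℕ.* z → z ≡ 1 → m ≡ p ^ e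
    unit e refl refl = ℕ.*-identityʳ (p ^ e)

    go : ∀ k → 2 ≤ k → k ≤ 5 → M p k (scale ((k ℕ.∸ 1) ℕ.⊓ 3) a) (scale k b) ≡ p ^ k
    go 1 (s≤s ()) _
    go 2 _ _ = unit 2 (M-step₂ 0 a b) (Z-zero 1ℤ (scale 1 1ℤ) a b)
    go 3 _ _ = unit 3 (M-step₃ 0 a b) (Z-zero (scale 1 1ℤ) 1ℤ a b)
    go 4 _ _ = unit 4 (M-step₄ 0 a b) (Z-zero 1ℤ (scale 2 1ℤ) (scale 1 a) b)
    go 5 _ _ = unit 5 (M-step₅ 0 a b) (Z-zero (scale 1 1ℤ) (scale 1 1ℤ) a b)
    go (suc (suc (suc (suc (suc (suc _)))))) _ (s≤s (s≤s (s≤s (s≤s (s≤s ())))))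

  -- The value of `M` in each row

  private
    power : ∀ {m z} e j → m ≡ p ^ e ℕ.* z → z ≡ p ^ j → m ≡ p ^ (e ℕ.+ j)
    power e j refl refl = sym (ℕ.^-distribˡ-+-* p e j)

    -- `q` is the quotient occurring in `value`, which agrees with the cofactor `b` only by
    -- `quot-scale`.
    character : ∀ {m z b q} e j → q ≡ b → ¬ + p ∣ b → m ≡ p ^ e ℕ.* z → z ≡ p ^ j ℕ.* roots b →
      + m ≡ (1ℤ + χ p q) * + (p ^ (e ℕ.+ j))
    character {b = b} e j refl p∤b refl refl = begin
      + (p ^ e ℕ.* (p ^ j ℕ.* roots b))   ≡⟨ cong +_ (regroup (p ^ e) (p ^ j) (roots b)) ⟩
      + (roots b ℕ.* (p ^ e ℕ.* p ^ j))   ≡⟨ ℤ.pos-* (roots b) _ ⟩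
      + roots b * + (p ^ e ℕ.* p ^ j)     ≡⟨ cong₂ (λ i n → i * + n) (roots-χ p∤b)
                                                 (sym (ℕ.^-distribˡ-+-* p e j)) ⟩
      (1ℤ + χ p b) * + (p ^ (e ℕ.+ j))    ∎
      where
      open ≡-Reasoning
      regroup : ∀ q r n → q ℕ.* (r ℕ.* n) ≡ n ℕ.* (q ℕ.* r)
      regroup = ℕSolver.solve-∀

    vanish : ∀ {m z} e → m ≡ p ^ e ℕ.* z → z ≡ 0 → + m ≡ 0ℤ
    vanish e refl refl = cong +_ (ℕ.*-zeroʳ (p ^ e))

    transport : ∀ r j {A A′ B B′} → A ≡ A′ → B ≡ B′ →
      + M p (h r ℕ.+ j) A′ B′ ≡ value p A′ B′ r (h r ℕ.+ j) →
      + M p (h r ℕ.+ j) A B ≡ value p A B r (h r ℕ.+ j)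
    transport r j refl refl eq = eq

  M-value : ∀ r j A B → [ 1 ] ≤⁺ v p A → [ 1 ] ≤⁺ v p B → Applies r (v p A) (v p B) →
    + M p (h r ℕ.+ j) A B ≡ value p A B r (h r ℕ.+ j)
  M-value row1 j A B 1≤α 1≤β β≡1 =
    let a , A≡ = ≤v⇒scale 1 A 1≤α ; b , B≡ , p∤b = v≡⇒scale 1 B β≡1 in
    transport row1 j A≡ B≡ (cong +_ (M-none j a p∤b))
  M-value row2 j A B 1≤α 1≤β (α≡1 , 2≤β) =
    let a , A≡ , p∤a = v≡⇒scale 1 A α≡1 ; b , B≡ = ≤v⇒scale 2 B 2≤β in
    transport row2 j A≡ B≡ (cong +_ (power 2 j (M-step₂ j a b) (Z-unit-a j 1ℤ 1ℤ b p∤a)))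
  M-value row3 j A B 1≤α 1≤β (2≤α , β≡2) =
    let a , A≡ = ≤v⇒scale 2 A 2≤α ; b , B≡ , p∤b = v≡⇒scale 2 B β≡2 in
    -- The threshold is one more than the exponent of the step, since `Z-unit-b` needs a positive
    -- exponent; rows 5 and 7 do the same, the latter for `Z-none`.
    transport row3 j A≡ B≡ (character 2 (suc j) (quot-scale 2 b) p∤b
      (M-step₂ (suc j) (scale 1 a) b) (Z-unit-b j 1ℤ a p∤b))
  M-value row4 j A B 1≤α 1≤β (2≤α , 3≤β , _) =
    let a , A≡ = ≤v⇒scale 2 A 2≤α ; b , B≡ = ≤v⇒scale 3 B 3≤β in
    transport row4 j A≡ B≡ (cong +_ (trans (M-step₃ (suc j) a b)
      (cong (p ^ 3 ℕ.*_) (trans (sym (K-Z (suc j) a b))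
        (cong₂ (K p (suc j)) (sym (quot-scale 2 a)) (sym (quot-scale 3 b)))))))
  M-value row5 j A B 1≤α 1≤β (3≤α , β≡4) =
    let a , A≡ = ≤v⇒scale 3 A 3≤α ; b , B≡ , p∤b = v≡⇒scale 4 B β≡4 in
    transport row5 j A≡ B≡ (character 4 (suc j) (quot-scale 4 b) p∤b
      (M-step₄ (suc j) a b) (Z-unit-b j (scale 1 1ℤ) a p∤b))
  M-value row6 j A B 1≤α 1≤β (α≡3 , 5≤β) =
    let a , A≡ , p∤a = v≡⇒scale 3 A α≡3 ; b , B≡ = ≤v⇒scale 5 B 5≤β in
    transport row6 j A≡ B≡ (cong +_ (power 5 j (M-step₅ j a b) (Z-unit-a j (scale 1 1ℤ) 1ℤ b p∤a)))
  M-value row7 j A B 1≤α 1≤β (4≤α , β≡5) =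
    let a , A≡ = ≤v⇒scale 4 A 4≤α ; b , B≡ , p∤b = v≡⇒scale 5 B β≡5 in
    transport row7 j A≡ B≡ (vanish 5 (M-step₅ (suc j) (scale 1 a) b) (Z-none j 1ℤ 1ℤ a p∤b))
  M-value row8 j A B 1≤α 1≤β (4≤α , 6≤β) =
    let a , A≡ = ≤v⇒scale 4 A 4≤α ; b , B≡ = ≤v⇒scale 6 B 6≤β in
    transport row8 j A≡ B≡ (cong +_ (trans (M-step₆ j a b)
      (cong (p ^ 7 ℕ.*_) (trans (sym (N-Z j a b))
        (cong₂ (N p j) (sym (quot-scale 4 a)) (sym (quot-scale 6 b)))))))

h≤6 : ∀ r → h r ≤ 6
h≤6 row1 = ℕ.m≤m+n 2 4
h≤6 row2 = ℕ.m≤m+n 2 4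
h≤6 row3 = ℕ.m≤m+n 3 3
h≤6 row4 = ℕ.m≤m+n 4 2
h≤6 row5 = ℕ.m≤m+n 5 1
h≤6 row6 = ℕ.m≤m+n 5 1
h≤6 row7 = ℕ.≤-refl
h≤6 row8 = ℕ.≤-refl

theorem13 :
    (p : ℕ) (p-prime : Prime p) → 5 ≤ p →
    (A B : ℤ) → + p ∣ A → + p ∣ B →
    ∃! _≡_ (λ r → Applies r (v p A) (v p B)) ×
    (∀ r → Applies r (v p A) (v p B) →
      M p 1 A B ≡ 1 ×
      (∀ k → 2 ≤ k → k < h r → M p k A B ≡ p ^ k) ×
      (∀ k → h r ≤ k →
        + M p k A B ≡ value p {{prime⇒nonZero p-prime}} A B r k))
theorem13 p p-prime 5≤p A B p∣A p∣B = existsUnique , λ r applies →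
  M-one A p∣B ,
  (λ k 2≤k k<h → let α≥ , β≥ = lower-bounds r 1≤α 1≤β applies in
    -- From `k < h r ≤ 6` follows `k ≤ 5`; the bounds at `h r ∸ 1` pass to smaller `k` by
    -- monotonicity.
    M-initial k A B 2≤k (ℕ.s≤s⁻¹ (ℕ.≤-trans k<h (h≤6 r)))
      (≤⁺-trans ℕ.≤-trans [ ℕ.⊓-monoˡ-≤ 3 (ℕ.∸-monoˡ-≤ 2 k<h) ] α≥)
      (≤⁺-trans ℕ.≤-trans [ ℕ.∸-monoˡ-≤ 1 k<h ] β≥)) ,
  λ k h≤k → subst (λ k → + M p k A B ≡ value p {{prime⇒nonZero p-prime}} A B r k) (ℕ.m+[n∸m]≡n h≤k)
    (M-value r (k ℕ.∸ h r) A B 1≤α 1≤β applies)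
  where
  open OddPrime p p-prime (ℕ.≤-trans (ℕ.m≤m+n 3 2) 5≤p)
  1≤α : [ 1 ] ≤⁺ v p A
  1≤α = ^∣⇒≤v 1 A (subst (λ n → + n ∣ A) (sym (ℕ.*-identityʳ p)) p∣A)
  1≤β : [ 1 ] ≤⁺ v p B
  1≤β = ^∣⇒≤v 1 B (subst (λ n → + n ∣ B) (sym (ℕ.*-identityʳ p)) p∣B)
  existsUnique : ∃! _≡_ (λ r → Applies r (v p A) (v p B))
  existsUnique with r , applies ← row-exists 1≤α 1≤β =
    r , applies , λ {s} applies′ → trans (sym (row-unique r applies)) (row-unique s applies′)
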